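{- Let $\lambda$ be a real number. If some instantiation $A$ of the Greedy Algorithm $\mathrm{GA}$ for the Shortest Common Superstring problem is $\lambda$-approximate, then every other instantiation of $\mathrm{GA}$ is also $\lambda$-approximate.
   Context: Strings are finite words over arbitrary finite alphabets (datasets are not confined to one fixed finite alphabet; a symbol not occurring in a given dataset is always available). $|s|$ is the length of a string $s$. For strings $s,t$, $\mathrm{overlap}(s,t)$ is the longest string $y$ such that $s=xy$ and $t=yz$ for some strings $x,z$; the string $xyz$ is then the merge of $s$ and $t$ (in this order). A dataset is a finite non-empty set $\mathcal{S}=\{s_1,\dots,s_n\}$ of strings such that no string of $\mathcal{S}$ is a substring of another. A superstring of $\mathcal{S}$ is a string containing every $s_i$ as a substring. The Shortest Common Superstring problem (SCS) asks for a shortest superstring; $\mathrm{OPT}(\mathcal{S})$ denotes an optimal (shortest) superstring. The Greedy Algorithm $\mathrm{GA}$: starting from $\mathcal{S}$, while more than one string remains, choose an ordered pair of distinct remaining strings whose overlap has maximum length among all such ordered pairs, and replace the two strings by their merge; output the last remaining string. $\mathrm{GA}$ does not specify how to break ties. An instantiation $A$ of $\mathrm{GA}$ (written $A\in\mathrm{GA}$) is $\mathrm{GA}$ with an arbitrary tie-breaking rule, i.e. a procedure that for every dataset $\mathcal{S}$ performs one particular run of $\mathrm{GA}$ on $\mathcal{S}$; its output is denoted $A(\mathcal{S})$. The instantiation $A$ is $\lambda$-approximate if $|A(\mathcal{S})|\le\lambda\,|\mathrm{OPT}(\mathcal{S})|$ for every dataset $\mathcal{S}$. -}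

module Defs where

open import Data.Integer.Base using (+_)
open import Data.List.Base using (List; []; _∷_; [_]; _++_; length)
open import Data.List.Membership.Propositional using (_∈_)
open import Data.List.Relation.Binary.BagAndSetEquality using (_∼[_]_; set)
open import Data.List.Relation.Binary.Infix.Heterogeneous using (Infix)
open import Data.List.Relation.Binary.Permutation.Propositional using (_↭_)
open import Data.List.Relation.Unary.All using (All)
open import Data.List.Relation.Unary.Unique.Propositional using (Unique)
open import Data.Nat.Base as ℕ using (ℕ)
import Data.Nat.Properties as ℕ
open import Data.Product.Base using (∃; ∃₂; _×_; _,_; proj₁; proj₂)
open import Data.Rational.Base as ℚ using (ℚ; 0ℚ; 1ℚ; ∣_∣; Positive; NonZero)
import Data.Rational.Properties as ℚ
open import Data.Rational.Solver using (module +-*-Solver)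
open import Relation.Binary.Construct.Closure.ReflexiveTransitive using (Star)
open import Relation.Binary.PropositionalEquality
  using (_≡_; _≢_; refl; sym; trans; cong; subst)
open import Relation.Nullary.Negation using (¬_)

Cauchy : (ℕ → ℚ) → Set
Cauchy x = ∀ ε → 0ℚ ℚ.< ε →
  ∃ λ N → ∀ m n → N ℕ.≤ m → N ℕ.≤ n → ∣ x m ℚ.- x n ∣ ℚ.≤ ε

-- Distinct sequences may represent the same real; _≤ʳ_ below compares the limits.
record ℝ : Set where
  constructor mkℝ
  field
    seq    : ℕ → ℚ
    cauchy : Cauchy seq

open ℝ public

infix 4 _≤ʳ_

_≤ʳ_ : ℝ → ℝ → Set
x ≤ʳ y = ∀ ε → 0ℚ ℚ.< ε → ∃ λ N → ∀ n → N ℕ.≤ n → seq x n ℚ.≤ seq y n ℚ.+ ε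

fromℚ : ℚ → ℝ
fromℚ q = mkℝ (λ _ → q) λ ε 0<ε → 0 , λ _ _ _ _ →
  subst (ℚ._≤ ε) (sym (cong ∣_∣ (ℚ.+-inverseʳ q))) (ℚ.<⇒≤ 0<ε)

fromℕ : ℕ → ℝ
fromℕ n = fromℚ (+ n ℚ./ 1)

private

  module _ where
    open +-*-Solver

    p≡q+[p-q] : ∀ p q → p ≡ q ℚ.+ (p ℚ.- q)
    p≡q+[p-q] = solve 2 (λ p q → p := q :+ (p :- q)) refl

    factor : ∀ k l e r → k ℚ.* (e ℚ.* r) ℚ.+ (e ℚ.* r) ℚ.* l ≡ e ℚ.* (r ℚ.* (k ℚ.+ l))
    factor = solve 4 (λ k l e r → k :* (e :* r) :+ (e :* r) :* l := e :* (r :* (k :+ l))) refl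

    split : ∀ a b c d → a ℚ.* b ℚ.- c ℚ.* d ≡ a ℚ.* (b ℚ.- d) ℚ.+ (a ℚ.- c) ℚ.* d
    split = solve 4 (λ a b c d → a :* b :- c :* d := a :* (b :- d) :+ (a :- c) :* d) refl

  bounded : ∀ x → Cauchy x →
    ∃₂ λ K N → Positive K × (∀ n → N ℕ.≤ n → ∣ x n ∣ ℚ.≤ K)
  bounded x c with c 1ℚ (ℚ.positive⁻¹ 1ℚ)
  ... | N , close = ∣ x N ∣ ℚ.+ 1ℚ , N , K>0 , bound
    where
    K>0 : Positive (∣ x N ∣ ℚ.+ 1ℚ)
    K>0 = ℚ.positive (ℚ.+-mono-≤-< (ℚ.0≤∣p∣ (x N)) (ℚ.positive⁻¹ 1ℚ))

    bound : ∀ n → N ℕ.≤ n → ∣ x n ∣ ℚ.≤ ∣ x N ∣ ℚ.+ 1ℚ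
    bound n N≤n = begin
      ∣ x n ∣                         ≡⟨ cong ∣_∣ (p≡q+[p-q] (x n) (x N)) ⟩
      ∣ x N ℚ.+ (x n ℚ.- x N) ∣       ≤⟨ ℚ.∣p+q∣≤∣p∣+∣q∣ (x N) (x n ℚ.- x N) ⟩
      ∣ x N ∣ ℚ.+ ∣ x n ℚ.- x N ∣     ≤⟨ ℚ.+-monoʳ-≤ ∣ x N ∣ (close n N N≤n ℕ.≤-refl) ⟩
      ∣ x N ∣ ℚ.+ 1ℚ                  ∎
      where open ℚ.≤-Reasoning

  *-mono-≤-abs : ∀ p q {a b} → ∣ p ∣ ℚ.≤ a → ∣ q ∣ ℚ.≤ b → ∣ p ℚ.* q ∣ ℚ.≤ a ℚ.* b
  *-mono-≤-abs p q {a} {b} p≤a q≤b = begin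
    ∣ p ℚ.* q ∣        ≡⟨ ℚ.∣p*q∣≡∣p∣*∣q∣ p q ⟩
    ∣ p ∣ ℚ.* ∣ q ∣    ≤⟨ ℚ.*-monoˡ-≤-nonNeg ∣ p ∣ {{ℚ.∣-∣-nonNeg p}} q≤b ⟩
    ∣ p ∣ ℚ.* b        ≤⟨ ℚ.*-monoʳ-≤-nonNeg b {{ℚ.nonNegative (ℚ.≤-trans (ℚ.0≤∣p∣ q) q≤b)}} p≤a ⟩
    a ℚ.* b            ∎
    where open ℚ.≤-Reasoning

  *-close : ∀ K L δ a b c d →
    ∣ a ∣ ℚ.≤ K → ∣ b ℚ.- d ∣ ℚ.≤ δ → ∣ a ℚ.- c ∣ ℚ.≤ δ → ∣ d ∣ ℚ.≤ L →
    ∣ a ℚ.* b ℚ.- c ℚ.* d ∣ ℚ.≤ K ℚ.* δ ℚ.+ δ ℚ.* L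
  *-close K L δ a b c d a≤K b-d≤δ a-c≤δ d≤L = begin
    ∣ a ℚ.* b ℚ.- c ℚ.* d ∣
      ≡⟨ cong ∣_∣ (split a b c d) ⟩
    ∣ a ℚ.* (b ℚ.- d) ℚ.+ (a ℚ.- c) ℚ.* d ∣
      ≤⟨ ℚ.∣p+q∣≤∣p∣+∣q∣ (a ℚ.* (b ℚ.- d)) ((a ℚ.- c) ℚ.* d) ⟩
    ∣ a ℚ.* (b ℚ.- d) ∣ ℚ.+ ∣ (a ℚ.- c) ℚ.* d ∣
      ≤⟨ ℚ.+-mono-≤ (*-mono-≤-abs a (b ℚ.- d) a≤K b-d≤δ) (*-mono-≤-abs (a ℚ.- c) d a-c≤δ d≤L) ⟩
    K ℚ.* δ ℚ.+ δ ℚ.* L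
      ∎
    where open ℚ.≤-Reasoning

  shrink : ∀ K L ε → .{{Positive (K ℚ.+ L)}} → 0ℚ ℚ.< ε →
    ∃ λ δ → 0ℚ ℚ.< δ × K ℚ.* δ ℚ.+ δ ℚ.* L ≡ ε
  shrink K L ε {{S>0}} 0<ε = ε ℚ.* S⁻¹ , 0<δ , eq
    where
    instance
      S≢0 : NonZero (K ℚ.+ L)
      S≢0 = ℚ.pos⇒nonZero (K ℚ.+ L)

    S⁻¹ : ℚ
    S⁻¹ = ℚ.1/ (K ℚ.+ L)

    0<δ : 0ℚ ℚ.< ε ℚ.* S⁻¹
    0<δ = ℚ.positive⁻¹ (ε ℚ.* S⁻¹)
      {{ℚ.pos*pos⇒pos ε {{ℚ.positive 0<ε}} S⁻¹ {{ℚ.1/pos⇒pos (K ℚ.+ L)}}}}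

    eq : K ℚ.* (ε ℚ.* S⁻¹) ℚ.+ (ε ℚ.* S⁻¹) ℚ.* L ≡ ε
    eq = trans (factor K L ε S⁻¹)
      (trans (cong (ε ℚ.*_) (ℚ.*-inverseˡ (K ℚ.+ L))) (ℚ.*-identityʳ ε))

  *-cauchy : ∀ x y → Cauchy x → Cauchy y → Cauchy (λ n → x n ℚ.* y n)
  *-cauchy x y cx cy ε 0<ε =
    let K , N₁ , K>0 , x≤K = bounded x cx
        L , N₂ , L>0 , y≤L = bounded y cy
        δ , 0<δ , eq = shrink K L ε {{ℚ.pos+pos⇒pos K {{K>0}} L {{L>0}}}} 0<ε
        N₃ , x-close = cx δ 0<δ
        N₄ , y-close = cy δ 0<δ
        N₁≤ = ℕ.≤-trans (ℕ.m≤m⊔n N₁ N₂) (ℕ.m≤m⊔n (N₁ ℕ.⊔ N₂) (N₃ ℕ.⊔ N₄))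
        N₂≤ = ℕ.≤-trans (ℕ.m≤n⊔m N₁ N₂) (ℕ.m≤m⊔n (N₁ ℕ.⊔ N₂) (N₃ ℕ.⊔ N₄))
        N₃≤ = ℕ.≤-trans (ℕ.m≤m⊔n N₃ N₄) (ℕ.m≤n⊔m (N₁ ℕ.⊔ N₂) (N₃ ℕ.⊔ N₄))
        N₄≤ = ℕ.≤-trans (ℕ.m≤n⊔m N₃ N₄) (ℕ.m≤n⊔m (N₁ ℕ.⊔ N₂) (N₃ ℕ.⊔ N₄))
    in (N₁ ℕ.⊔ N₂) ℕ.⊔ (N₃ ℕ.⊔ N₄) , λ m n N≤m N≤n →
      subst (∣ x m ℚ.* y m ℚ.- x n ℚ.* y n ∣ ℚ.≤_) eq
        (*-close K L δ (x m) (y m) (x n) (y n)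
          (x≤K m (ℕ.≤-trans N₁≤ N≤m))
          (y-close m n (ℕ.≤-trans N₄≤ N≤m) (ℕ.≤-trans N₄≤ N≤n))
          (x-close m n (ℕ.≤-trans N₃≤ N≤m) (ℕ.≤-trans N₃≤ N≤n))
          (y≤L n (ℕ.≤-trans N₂≤ N≤n)))

infixl 7 _*ʳ_

_*ʳ_ : ℝ → ℝ → ℝ
x *ʳ y = mkℝ (λ n → seq x n ℚ.* seq y n) (*-cauchy (seq x) (seq y) (cauchy x) (cauchy y))

-- Every finite alphabet embeds in ℕ, and no finite collection of strings
-- uses up all symbols.
Symbol : Set
Symbol = ℕ

String : Set
String = List Symbol

_⊑_ : String → String → Set
_⊑_ = Infix _≡_

-- y is the longest string with s = x y and t = y z.
record Overlap (s t x y z : String) : Set where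
  field
    left    : s ≡ x ++ y
    right   : t ≡ y ++ z
    longest : ∀ {x′ y′ z′} → s ≡ x′ ++ y′ → t ≡ y′ ++ z′ → length y′ ℕ.≤ length y

record Dataset : Set where
  field
    strings   : List String
    nonEmpty  : strings ≢ []
    unique    : Unique strings
    antichain : ∀ {s t} → s ∈ strings → t ∈ strings → s ≢ t → ¬ (s ⊑ t)

open Dataset public

_≈_ : Dataset → Dataset → Set
S ≈ T = strings S ∼[ set ] strings T

IsSuperstring : Dataset → String → Set
IsSuperstring S u = All (_⊑ u) (strings S)

IsOPT : Dataset → String → Set
IsOPT S u = IsSuperstring S u × (∀ v → IsSuperstring S v → length u ℕ.≤ length v)

infix 4 _⟶_

-- The remaining strings are listed without repetition: a greedy merge is not a
-- substring of any other remaining string and contains none of them.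
data _⟶_ (P : List String) : List String → Set where
  merge : ∀ {s t x y z R} →
    P ↭ s ∷ t ∷ R → s ≢ t → Overlap s t x y z →
    (∀ {s′ t′ x′ y′ z′} → s′ ∈ P → t′ ∈ P → s′ ≢ t′ →
       Overlap s′ t′ x′ y′ z′ → length y′ ℕ.≤ length y) →
    P ⟶ (x ++ y ++ z) ∷ R

GreedyOutput : Dataset → String → Set
GreedyOutput S u = Star _⟶_ (strings S) [ u ]

-- Datasets are sets, so the output may not depend on the order in which the
-- strings are listed.
record Instantiation : Set where
  field
    output      : Dataset → String
    output-run  : ∀ S → GreedyOutput S (output S)
    output-cong : ∀ {S T} → S ≈ T → output S ≡ output T

open Instantiation public

_-approximate_ : ℝ → Instantiation → Set
r -approximate A = ∀ S {u} → IsOPT S u →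
  fromℕ (length (output A S)) ≤ʳ r *ʳ fromℕ (length u)

{-# OPTIONS --safe #-}
module Submission where

-- Encode a string c₁ … cₖ as 0ʷ c₁ 0ᴹ c₂ 0ᴹ … 0ᴹ cₖ 0ᵐ⁺ᵉ with M = m + N and w, e ≤ N, where
-- N is the number of strings. A nonempty overlap of length k becomes one of length
-- k (M + 1) + w + e − N, where w and e come from the facing ends, so w and e only break ties;
-- an empty overlap becomes one of length at most w. Giving the pairs merged by the run of B (up to the first
-- merge without overlap) facing weights that decrease along the run makes every greedy run on
-- the encoded dataset imitate the run of B. All lengths are thus multiplied by M + 1 up to an error
-- depending only on N, and the ratio of A on the encoded datasets is in the limit m → ∞ at least
-- that of B. An optimal superstring of the encoded dataset exists only up to double negation,
-- which suffices because _≤ʳ_ is stable.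

open import Defs
open import Data.Product.Base using (∃-syntax)

-- Rational and real estimates

module Approximation where

  open import Data.Integer.Base as ℤ using (+_; -[1+_])
  import Data.Integer.Properties as ℤ
  open import Data.Nat.Base as ℕ using (ℕ; zero; suc)
  import Data.Nat.Properties as ℕ
  open import Data.Nat.Coprimality using (sym; 1-coprimeTo)
  open import Data.Product.Base using (∃; _×_; _,_)
  open import Data.Rational.Base
  open import Data.Sum.Base using (inj₁; inj₂)
  open import Data.Rational.Properties
  open import Data.Rational.Solver using (module +-*-Solver)
  open import Data.Rational.Unnormalised.Base as ℚᵘ using (mkℚᵘ; *≤*)
  import Data.Rational.Unnormalised.Properties as ℚᵘ
  open import Relation.Binary.PropositionalEquality hiding (sym)
  import Relation.Binary.PropositionalEquality as ≡
  open import Relation.Nullary using (yes; no; ¬_; contradiction)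

  ι : ℕ → ℚ
  ι n = + n / 1

  -- The gcd inside `_/_` does not reduce for a variable `n`, so the arithmetic of `ι` is carried
  -- out on unnormalised rationals.
  toℚᵘ-ι : ∀ n → toℚᵘ (ι n) ≡ mkℚᵘ (+ n) 0
  toℚᵘ-ι n = cong toℚᵘ (↥p/↧p≡p (mkℚ (+ n) 0 (sym (1-coprimeTo n))))

  ι-+ : ∀ m n → ι (m ℕ.+ n) ≡ ι m + ι n
  ι-+ m n = toℚᵘ-injective (begin
    toℚᵘ (ι (m ℕ.+ n))             ≡⟨ toℚᵘ-ι (m ℕ.+ n) ⟩
    mkℚᵘ (+ (m ℕ.+ n)) 0           ≡⟨ cong₂ (λ a b → mkℚᵘ (a ℤ.+ b) 0)
                                          (ℤ.*-identityʳ (+ m)) (ℤ.*-identityʳ (+ n)) ⟨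
    mkℚᵘ (+ m) 0 ℚᵘ.+ mkℚᵘ (+ n) 0 ≡⟨ cong₂ ℚᵘ._+_ (toℚᵘ-ι m) (toℚᵘ-ι n) ⟨
    toℚᵘ (ι m) ℚᵘ.+ toℚᵘ (ι n)     ≈⟨ toℚᵘ-homo-+ (ι m) (ι n) ⟨
    toℚᵘ (ι m + ι n)               ∎)
    where open ℚᵘ.≃-Reasoning

  ι-* : ∀ m n → ι (m ℕ.* n) ≡ ι m * ι n
  ι-* m n = toℚᵘ-injective (begin
    toℚᵘ (ι (m ℕ.* n))             ≡⟨ toℚᵘ-ι (m ℕ.* n) ⟩
    mkℚᵘ (+ (m ℕ.* n)) 0           ≡⟨ cong (λ a → mkℚᵘ a 0) (ℤ.pos-* m n) ⟩
    mkℚᵘ (+ m) 0 ℚᵘ.* mkℚᵘ (+ n) 0 ≡⟨ cong₂ ℚᵘ._*_ (toℚᵘ-ι m) (toℚᵘ-ι n) ⟨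
    toℚᵘ (ι m) ℚᵘ.* toℚᵘ (ι n)     ≈⟨ toℚᵘ-homo-* (ι m) (ι n) ⟨
    toℚᵘ (ι m * ι n)               ∎)
    where open ℚᵘ.≃-Reasoning

  ι-mono : ∀ {m n} → m ℕ.≤ n → ι m ≤ ι n
  ι-mono {m} {n} m≤n = toℚᵘ-cancel-≤ (subst₂ ℚᵘ._≤_ (≡.sym (toℚᵘ-ι m)) (≡.sym (toℚᵘ-ι n))
    (*≤* (ℤ.*-monoʳ-≤-nonNeg (+ 1) (ℤ.+≤+ m≤n))))

  0≤ι : ∀ n → 0ℚ ≤ ι n
  0≤ι n = ι-mono {0} {n} ℕ.z≤n

  ι-positive : ∀ n → Positive (ι (suc n))
  ι-positive n = positive (<-≤-trans (positive⁻¹ 1ℚ) (ι-mono {1} {suc n} (ℕ.s≤s ℕ.z≤n)))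

  ≤-ι-ceiling : ∀ q → ∃ λ n → q ≤ ι n
  ≤-ι-ceiling q@(mkℚ (-[1+ _ ]) _ _) = 0 , nonPositive⁻¹ q
  -- The denominator is at least 1, so the numerator is an upper bound.
  ≤-ι-ceiling q@(mkℚ (+ k) d _) = k , toℚᵘ-cancel-≤ (subst (toℚᵘ q ℚᵘ.≤_) (≡.sym (toℚᵘ-ι k))
    (*≤* (ℤ.*-monoˡ-≤-nonNeg (+ k) (ℤ.+≤+ (ℕ.s≤s ℕ.z≤n)))))

  archimedean : ∀ {δ} → 0ℚ < δ → ∀ q → ∃ λ n → q ≤ ι n * δ
  archimedean {δ} 0<δ q = let n , p = ≤-ι-ceiling (q * δ⁻¹) in n , (begin
    q                ≡⟨ *-identityʳ q ⟨
    q * 1ℚ           ≡⟨ cong (q *_) (*-inverseˡ δ) ⟨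
    q * (δ⁻¹ * δ)    ≡⟨ *-assoc q δ⁻¹ δ ⟨
    q * δ⁻¹ * δ      ≤⟨ *-monoʳ-≤-nonNeg δ {{pos⇒nonNeg δ}} p ⟩
    ι n * δ          ∎)
    where
    open ≤-Reasoning
    instance
      δ>0 : Positive δ
      δ>0 = positive 0<δ
      δ≢0 : NonZero δ
      δ≢0 = pos⇒nonZero δ
    δ⁻¹ = 1/ δ

  ∣p-q∣≤⇒p≤q+ : ∀ {p q ε} → ∣ p - q ∣ ≤ ε → p ≤ q + ε
  ∣p-q∣≤⇒p≤q+ {p} {q} {ε} c = begin
    p                ≡⟨ solve 2 (λ p q → p := q :+ (p :- q)) refl p q ⟩
    q + (p - q)      ≤⟨ +-monoʳ-≤ q (p≤∣p∣ (p - q)) ⟩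
    q + ∣ p - q ∣    ≤⟨ +-monoʳ-≤ q c ⟩
    q + ε            ∎
    where
    open ≤-Reasoning
    open +-*-Solver
    p≤∣p∣ : ∀ p → p ≤ ∣ p ∣
    p≤∣p∣ p with ≤-total 0ℚ p
    ... | inj₁ 0≤p = ≤-reflexive (≡.sym (0≤p⇒∣p∣≡p 0≤p))
    ... | inj₂ p≤0 = ≤-trans p≤0 (0≤∣p∣ p)

  -- The comparison at a single late index decides x ≤ y up to ε, so double negations
  -- can be removed.
  ≤ʳ-stable : ∀ {x y} →
    (∀ ε → 0ℚ < ε → ¬ ¬ ∃ λ N → ∀ n → N ℕ.≤ n → seq x n ≤ seq y n + ε) → x ≤ʳ y
  ≤ʳ-stable {x} {y} h ε 0<ε = conclude (cauchy x δ 0<δ) (cauchy y δ 0<δ)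
    where
    open ≤-Reasoning
    -- Refuting the comparison at `N` with slack 3δ takes one δ each for `x`, `y` and the late
    -- inequality; carrying a positive answer from `N` to any later index costs two more.
    δ = ε * (+ 1 / 5)
    0<δ : 0ℚ < δ
    0<δ = positive⁻¹ δ {{pos*pos⇒pos ε {{positive 0<ε}} (+ 1 / 5)}}

    5δ : δ + δ + δ + δ + δ ≡ ε
    5δ = trans (solve 1 (λ e → e :* f :+ e :* f :+ e :* f :+ e :* f :+ e :* f
        := e :* (f :+ f :+ f :+ f :+ f)) refl ε) (*-identityʳ ε)
      where
      open +-*-Solver
      f : ∀ {n} → Polynomial n
      f = con (+ 1 / 5)

    conclude : (∃ λ N → ∀ m n → N ℕ.≤ m → N ℕ.≤ n → ∣ seq x m - seq x n ∣ ≤ δ) →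
      (∃ λ N → ∀ m n → N ℕ.≤ m → N ℕ.≤ n → ∣ seq y m - seq y n ∣ ≤ δ) →
      ∃ λ N → ∀ n → N ℕ.≤ n → seq x n ≤ seq y n + ε
    conclude (N₁ , xc) (N₂ , yc) with seq x N ≤? seq y N + δ + δ + δ
      where N = N₁ ℕ.⊔ N₂
    ... | yes le = N₁ ℕ.⊔ N₂ , λ n N≤n → begin
      seq x n                            ≤⟨ ∣p-q∣≤⇒p≤q+ (xc n N (ℕ.≤-trans N₁≤ N≤n) N₁≤) ⟩
      seq x N + δ                        ≤⟨ +-monoˡ-≤ δ le ⟩
      seq y N + δ + δ + δ + δ            ≤⟨ +-monoˡ-≤ δ (+-monoˡ-≤ δ (+-monoˡ-≤ δ (+-monoˡ-≤ δ
                                              (∣p-q∣≤⇒p≤q+ {seq y N} {seq y n} (yc N n N₂≤ (ℕ.≤-trans N₂≤ N≤n)))))) ⟩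
      seq y n + δ + δ + δ + δ + δ        ≡⟨ solve 2 (λ y d → y :+ d :+ d :+ d :+ d :+ d
                                                         := y :+ (d :+ d :+ d :+ d :+ d)) refl (seq y n) δ ⟩
      seq y n + (δ + δ + δ + δ + δ)      ≡⟨ cong (λ p → seq y n + p) 5δ ⟩
      seq y n + ε                        ∎
      where
      open +-*-Solver
      N = N₁ ℕ.⊔ N₂
      N₁≤ = ℕ.m≤m⊔n N₁ N₂
      N₂≤ = ℕ.m≤n⊔m N₁ N₂
    ... | no ¬le = contradiction (λ (K , late) → ¬le (begin
      seq x N                            ≤⟨ ∣p-q∣≤⇒p≤q+ (xc N (N ℕ.⊔ K) N₁≤ (ℕ.≤-trans N₁≤ (ℕ.m≤m⊔n N K))) ⟩
      seq x (N ℕ.⊔ K) + δ                ≤⟨ +-monoˡ-≤ δ (late (N ℕ.⊔ K) (ℕ.m≤n⊔m N K)) ⟩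
      seq y (N ℕ.⊔ K) + δ + δ            ≤⟨ +-monoˡ-≤ δ (+-monoˡ-≤ δ
                                              (∣p-q∣≤⇒p≤q+ {seq y (N ℕ.⊔ K)} {seq y N}
                                                (yc (N ℕ.⊔ K) N (ℕ.≤-trans N₂≤ (ℕ.m≤m⊔n N K)) N₂≤))) ⟩
      seq y N + δ + δ + δ                ∎)) (h δ 0<δ)
      where
      N = N₁ ℕ.⊔ N₂
      N₁≤ = ℕ.m≤m⊔n N₁ N₂
      N₂≤ = ℕ.m≤n⊔m N₁ N₂

  -- The additive losses C and K N do not grow with G, so dividing by suc G makes them at most δ.
  descale : ∀ {a b o o′ N C G K q δ} → 0ℚ ≤ q → q ≤ K →
    b ℕ.* suc G ℕ.≤ a ℕ.+ C → o′ ℕ.≤ N ℕ.+ o ℕ.* suc G →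
    ι a ≤ q * ι o′ + 1ℚ → K * ι N + 1ℚ + ι C ≤ ι (suc G) * δ →
    ι b ≤ q * ι o + δ
  descale {a} {b} {o} {o′} {N} {C} {G} {K} {q} {δ} 0≤q q≤K b≤ o′≤ a≤ δ≥ =
    *-cancelʳ-≤-pos (ι (suc G)) {{ι-positive G}} (begin
      ι b * g                                ≡⟨ ι-* b (suc G) ⟨
      ι (b ℕ.* suc G)                        ≤⟨ ι-mono b≤ ⟩
      ι (a ℕ.+ C)                            ≡⟨ ι-+ a C ⟩
      ι a + ι C                              ≤⟨ +-monoˡ-≤ (ι C) a≤ ⟩
      q * ι o′ + 1ℚ + ι C                    ≤⟨ +-monoˡ-≤ (ι C) (+-monoˡ-≤ 1ℚ
                                                  (*-monoˡ-≤-nonNeg q {{nonNegative 0≤q}} (ι-mono o′≤))) ⟩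
      q * ι (N ℕ.+ o ℕ.* suc G) + 1ℚ + ι C   ≡⟨ cong (λ p → q * p + 1ℚ + ι C) (trans (ι-+ N (o ℕ.* suc G))
                                                  (cong (λ p → ι N + p) (ι-* o (suc G)))) ⟩
      q * (ι N + ι o * g) + 1ℚ + ι C         ≡⟨ solve 6 (λ q n o g c e → q :* (n :+ o :* g) :+ e :+ c
                                                  := (q :* n :+ e :+ c) :+ q :* o :* g) refl q (ι N) (ι o) g (ι C) 1ℚ ⟩
      (q * ι N + 1ℚ + ι C) + q * ι o * g     ≤⟨ +-monoˡ-≤ (q * ι o * g) (+-monoˡ-≤ (ι C) (+-monoˡ-≤ 1ℚ
                                                  (*-monoʳ-≤-nonNeg (ι N) {{nonNegative (0≤ι N)}} q≤K))) ⟩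
      (K * ι N + 1ℚ + ι C) + q * ι o * g     ≤⟨ +-monoˡ-≤ (q * ι o * g) δ≥ ⟩
      g * δ + q * ι o * g                    ≡⟨ solve 4 (λ g d q o → g :* d :+ q :* o :* g := (q :* o :+ d) :* g) refl g δ q (ι o) ⟩
      (q * ι o + δ) * g                      ∎)
    where
    open ≤-Reasoning
    open +-*-Solver
    g = ι (suc G)

open Approximation

open import Data.Empty using (⊥)
open import Data.List using (initLast; _∷ʳ′_)
open import Data.List.Base
  using (List; []; _∷_; [_]; _++_; _∷ʳ_; length; map; concatMap; replicate)
open import Data.List.Membership.Propositional using (_∈_)
open import Data.List.Properties
open import Data.List.Relation.Binary.Infix.Heterogeneous using (toView; fromView; MkView)
open import Data.List.Relation.Binary.Permutation.Propositional
  using (_↭_; ↭-refl; ↭-reflexive; ↭-sym; ↭-trans; prep; ↭⇒↭ₛ)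
open import Data.List.Relation.Binary.Permutation.Propositional.Properties
  using (∈-resp-↭; All-resp-↭; ↭-length; ↭-map-inv; drop-∷; map⁺)
open import Data.List.Relation.Binary.Permutation.Setoid.Properties using (AllPairs-resp-↭)
import Data.List.Relation.Binary.Pointwise as Pointwise
import Data.List.Relation.Binary.Prefix.Heterogeneous as Prefix
open import Data.List.Relation.Binary.Prefix.Heterogeneous.Properties using (prefix?)
open import Data.List.Relation.Unary.All as All using (All; []; _∷_)
import Data.List.Relation.Unary.All.Properties as All
open import Data.List.Relation.Unary.AllPairs as AllPairs using (AllPairs; []; _∷_)
import Data.List.Relation.Unary.AllPairs.Properties as AllPairs
open import Data.List.Relation.Unary.Any using (here; there)
open import Data.Nat.Base
open import Data.Nat.ListAction using (sum)
open import Data.Nat.ListAction.Properties using (sum-↭)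
open import Data.Nat.Properties
open import Data.Nat.Solver using (module +-*-Solver)
open import Data.Product.Base using (∃; ∃₂; _×_; _,_; proj₁; proj₂)
open import Data.Rational.Base as ℚ using (ℚ; 0ℚ; 1ℚ)
import Data.Rational.Properties as ℚ
open import Data.Rational.Solver using () renaming (module +-*-Solver to ℚ-Solver)
open import Data.Sum.Base as Sum using (_⊎_; inj₁; inj₂)
open import Relation.Binary.Construct.Closure.ReflexiveTransitive using (Star; ε; _◅_)
open import Relation.Binary.Definitions using (Symmetric)
open import Relation.Binary.PropositionalEquality hiding ([_])
open import Relation.Nullary using (yes; no; ¬_; contradiction)

-- Greedy runs on pairwise incomparable strings

-- Levi's lemma; the letter `c` in the second case makes the two cases exclusive.
++-split : ∀ {A : Set} (a x : List A) {b y} → a ++ b ≡ x ++ y →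
  (∃ λ m → a ≡ x ++ m × y ≡ m ++ b) ⊎ (∃₂ λ c m → x ≡ a ++ c ∷ m × b ≡ c ∷ m ++ y)
++-split a       []      eq = inj₁ (a , refl , sym eq)
++-split []      (c ∷ x) eq = inj₂ (c , x , refl , eq)
++-split (d ∷ a) (c ∷ x) eq with refl ← ∷-injectiveˡ eq =
  Sum.map (λ (m , p , q) → m , cong (c ∷_) p , q)
          (λ (e , m , p , q) → e , m , cong (c ∷_) p , q)
          (++-split a x (∷-injectiveʳ eq))

++-cancel-length : ∀ {A : Set} (a x : List A) {b y} →
  length a ≡ length x → a ++ b ≡ x ++ y → b ≡ y
++-cancel-length []      []      _ eq = eq
++-cancel-length (_ ∷ a) (_ ∷ x) l eq =
  ++-cancel-length a x (suc-injective l) (∷-injectiveʳ eq)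

⊑-intro : ∀ a s b → s ⊑ (a ++ s ++ b)
⊑-intro a s b = fromView (MkView a (Pointwise.≡⇒Pointwise-≡ refl) b)

⊑-elim : ∀ {s t} → s ⊑ t → ∃₂ λ a b → t ≡ a ++ s ++ b
⊑-elim s⊑t with MkView a p b ← toView s⊑t with refl ← Pointwise.Pointwise-≡⇒≡ p = a , b , refl

⊑-refl : ∀ {s} → s ⊑ s
⊑-refl {s} = subst (s ⊑_) (++-identityʳ s) (⊑-intro [] s [])

⊑-trans : ∀ {s t u} → s ⊑ t → t ⊑ u → s ⊑ u
⊑-trans {s} s⊑t t⊑u with a , b , refl ← ⊑-elim s⊑t with c , d , refl ← ⊑-elim t⊑u =
  subst (s ⊑_) (trans (++-assoc c a _) (cong (c ++_)
    (trans (cong (a ++_) (sym (++-assoc s b d))) (sym (++-assoc a (s ++ b) d)))))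
    (⊑-intro (c ++ a) s (b ++ d))

++-⊑ˡ : ∀ s b → s ⊑ (s ++ b)
++-⊑ˡ = ⊑-intro []

++-⊑ʳ : ∀ a s → s ⊑ (a ++ s)
++-⊑ʳ a s = subst (λ u → s ⊑ (a ++ u)) (++-identityʳ s) (⊑-intro a s [])

infix 4 _∥_

-- `AllPairs _∥_` combines the fields `unique` and `antichain` of a dataset into one symmetric
-- condition, which survives permutations.
record _∥_ (s t : String) : Set where
  constructor _,_
  field
    ⋢ : ¬ (s ⊑ t)
    ⋣ : ¬ (t ⊑ s)

open _∥_

∥-sym : Symmetric _∥_
∥-sym (p , q) = q , p

∥⇒≢ : ∀ {s t} → s ∥ t → s ≢ t
∥⇒≢ (s⋢t , _) refl = s⋢t ⊑-refl

OverlapBound : ℕ → String → String → Set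
OverlapBound m s t = ∀ x y z → s ≡ x ++ y → t ≡ y ++ z → length y ≤ m

record Short (m : ℕ) (s t : String) : Set where
  constructor _,_
  field
    forward  : OverlapBound m s t
    backward : OverlapBound m t s

open Short

Short-sym : ∀ {m} → Symmetric (Short m)
Short-sym (p , q) = q , p

AllPairs-↭ : ∀ {A : Set} {R : A → A → Set} → Symmetric R →
  ∀ {xs ys} → xs ↭ ys → AllPairs R xs → AllPairs R ys
AllPairs-↭ {A} {R} sy p =
  AllPairs-resp-↭ (setoid A) sy (subst (R _) , subst (λ x → R x _)) (↭⇒↭ₛ p)

-- The suffixes of `s` are tried from the longest down; the first that is a prefix of `t` is the
-- overlap.
longest-overlap : ∀ s t → ∃ λ x → ∃₂ λ y z → Overlap s t x y z
longest-overlap []      t = [] , [] , t , record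
  { left = refl ; right = refl
  ; longest = λ {x′} p _ → ≤-reflexive (cong length (++-conicalʳ x′ _ (sym p))) }
longest-overlap (c ∷ s) t with prefix? _≟_ (c ∷ s) t
... | yes p with q Prefix.++ z ← Prefix.toView p with refl ← Pointwise.Pointwise-≡⇒≡ q =
  [] , c ∷ s , z , record
  { left = refl ; right = refl
  ; longest = λ {x′} {y′} p _ → subst (λ u → length y′ ≤ length u) (sym p) (length-++-≤ʳ y′ {x′}) }
... | no ¬p with x , y , z , o ← longest-overlap s t = c ∷ x , y , z , record
  { left = cong (c ∷_) (Overlap.left o) ; right = Overlap.right o
  ; longest = λ {x′} {y′} {z′} → longest′ x′ y′ z′ }
  where
  longest′ : OverlapBound (length y) (c ∷ s) t
  longest′ []       _ z′ refl refl =
    contradiction (Prefix.fromView (Pointwise.≡⇒Pointwise-≡ refl Prefix.++ z′)) ¬p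
  longest′ (_ ∷ x′) _ _  p    q    = Overlap.longest o {x′} (∷-injectiveʳ p) q

Greedy : List String → ℕ → Set
Greedy P m = ∀ {s t x y z} → s ∈ P → t ∈ P → s ≢ t → Overlap s t x y z → length y ≤ m

-- The greedy condition speaks of longest overlaps only, so one must be exhibited before it bounds
-- all the others.
greedy-bound : ∀ {P m s t} → Greedy P m → s ∈ P → t ∈ P → s ≢ t → OverlapBound m s t
greedy-bound {s = s} {t} g s∈ t∈ s≢t x y z p q with _ , _ , _ , o ← longest-overlap s t =
  ≤-trans (Overlap.longest o {x} {y} {z} p q) (g s∈ t∈ s≢t o)

AllPairs-zip∈ : ∀ {A : Set} {R T : A → A → Set} {xs} →
  (∀ {x y} → x ∈ xs → y ∈ xs → R x y → T x y) → AllPairs R xs → AllPairs T xs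
AllPairs-zip∈ f []       = []
AllPairs-zip∈ f (p ∷ ps) =
  All.tabulate (λ y∈ → f (here refl) (there y∈) (All.lookup p y∈))
  ∷ AllPairs-zip∈ (λ x∈ y∈ → f (there x∈) (there y∈)) ps

greedy-short : ∀ {P m} → Greedy P m → AllPairs _∥_ P → AllPairs (Short m) P
greedy-short g = AllPairs-zip∈ λ s∈ t∈ s∥t →
  (greedy-bound g s∈ t∈ (∥⇒≢ s∥t) , greedy-bound g t∈ s∈ (≢-sym (∥⇒≢ s∥t)))

-- A string inside the merge but inside neither part straddles the overlap, so it
-- overlaps the left part in more than y.
merge-∥ : ∀ x y z {u} → (x ++ y) ∥ u → (y ++ z) ∥ u →
  OverlapBound (length y) (x ++ y) u → (x ++ y ++ z) ∥ u
merge-∥ x y z {u} s∥u t∥u short = xyz⋢u , u⋢xyz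
  where
  xyz⋢u : ¬ ((x ++ y ++ z) ⊑ u)
  xyz⋢u p = ⋢ t∥u (⊑-trans (++-⊑ʳ x (y ++ z)) p)

  u⋢xyz : ¬ (u ⊑ (x ++ y ++ z))
  u⋢xyz p with a , b , eq ← ⊑-elim p with ++-split x a eq
  ... | inj₂ (c , m , refl , eq′) = ⋣ t∥u (subst (u ⊑_) (sym eq′) (⊑-intro (c ∷ m) u b))
  ... | inj₁ (m , refl , eq′) with ++-split (m ++ y) u (trans (++-assoc m y z) (sym eq′))
  ...   | inj₁ (k , eq″ , _) = ⋣ s∥u (subst (u ⊑_)
            (trans (cong (a ++_) (sym eq″)) (sym (++-assoc a m y))) (⊑-intro a u k))
  ...   | inj₂ (c , k , refl , refl) = straddle m refl eq′ short
    where
    straddle : ∀ m → u ≡ (m ++ y) ++ c ∷ k → u ++ b ≡ m ++ y ++ z →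
      OverlapBound (length y) ((a ++ m) ++ y) u → ⊥
    -- With `m` empty, `u` starts together with `y` and is a prefix of the right part.
    straddle []      _ eq′ _     = ⋣ t∥u (subst (u ⊑_) eq′ (++-⊑ˡ u b))
    straddle (d ∷ m) p _   short = contradiction
      (short a (d ∷ m ++ y) _ (++-assoc a (d ∷ m) y) p) (<⇒≱ (s≤s (length-++-≤ʳ y {m})))

-- An overlap of the merge with `u` lies within the part facing `u`; otherwise it would contain that
-- whole part, which would then be a substring of `u`.
merge-short : ∀ x y z {u n} → (x ++ y) ∥ u → (y ++ z) ∥ u →
  Short n (x ++ y) u → Short n (y ++ z) u → Short n (x ++ y ++ z) u
merge-short x y z {u} {n} s∥u t∥u s-u t-u = fwd , bwd
  where
  fwd : OverlapBound n (x ++ y ++ z) u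
  fwd x′ y′ z′ p refl with ++-split x x′ p
  ... | inj₁ (m , _ , refl) = contradiction
          (subst ((y ++ z) ⊑_) (sym (++-assoc m (y ++ z) z′)) (⊑-intro m (y ++ z) z′)) (⋢ t∥u)
  ... | inj₂ (c , m , _ , q) = forward t-u (c ∷ m) y′ z′ q refl

  bwd : OverlapBound n u (x ++ y ++ z)
  bwd x′ y′ z′ refl q with ++-split (x ++ y) y′ (trans (++-assoc x y z) q)
  ... | inj₁ (m , p , _) = backward s-u x′ y′ m refl p
  ... | inj₂ (c , m , refl , _) = contradiction (⊑-intro x′ (x ++ y) (c ∷ m)) (⋢ s∥u)

-- Maximality of the chosen overlap supplies the bound on the overlaps of the left part that
-- `merge-∥` asks for.
step-∥ : ∀ {P Q} → P ⟶ Q → AllPairs _∥_ P → AllPairs _∥_ Q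
step-∥ (merge {x = x} {y} {z} p _ record { left = refl ; right = refl } g) ps
  with ((_ ∷ s∥) ∷ t∥ ∷ R∥) ← AllPairs-↭ ∥-sym p ps
     | ((_ ∷ s-) ∷ _) ← AllPairs-↭ Short-sym p (greedy-short g ps)
  = All.tabulate (λ u∈ → merge-∥ x y z (All.lookup s∥ u∈) (All.lookup t∥ u∈)
      (forward (All.lookup s- u∈)))
    ∷ R∥

step-short : ∀ {P Q n} → P ⟶ Q → AllPairs _∥_ P → AllPairs (Short n) P → AllPairs (Short n) Q
step-short (merge {x = x} {y} {z} p _ record { left = refl ; right = refl } _) ps qs
  with ((_ ∷ s∥) ∷ t∥ ∷ _) ← AllPairs-↭ ∥-sym p ps
     | ((_ ∷ s-) ∷ t- ∷ R-) ← AllPairs-↭ Short-sym p qs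
  = All.tabulate (λ u∈ → merge-short x y z (All.lookup s∥ u∈) (All.lookup t∥ u∈)
      (All.lookup s- u∈) (All.lookup t- u∈))
    ∷ R-

-- Total length along greedy runs

size : List String → ℕ
size P = sum (map length P)

size-↭ : ∀ {P Q} → P ↭ Q → size P ≡ size Q
size-↭ p = sum-↭ (map⁺ length p)

size-merge : ∀ x y z R →
  size ((x ++ y) ∷ (y ++ z) ∷ R) ≡ length y + size ((x ++ y ++ z) ∷ R)
size-merge x y z R rewrite length-++ x {y} | length-++ y {z} | length-++ x {y ++ z} | length-++ y {z}
  = lemma (length x) (length y) (length z) (size R)
  where
  open +-*-Solver
  lemma : ∀ a b c r → (a + b) + ((b + c) + r) ≡ b + ((a + (b + c)) + r)
  lemma = solve 4 (λ a b c r → (a :+ b) :+ ((b :+ c) :+ r) := b :+ ((a :+ (b :+ c)) :+ r)) refl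

output-≤-size : ∀ {P u} → Star _⟶_ P [ u ] → length u ≤ size P
output-≤-size ε = m≤m+n _ 0
output-≤-size {P} (merge {x = x} {y} {z} {R} p _ record { left = refl ; right = refl } _ ◅ run) =
  ≤-trans (output-≤-size run) (≤-trans (m≤n+m _ (length y))
    (≤-reflexive (sym (trans (size-↭ p) (size-merge x y z R)))))

-- Overlaps stay empty along the run by `step-short`, so every merge is a plain concatenation and
-- the order of merging does not affect the length.
size-≤-output : ∀ {P u} → AllPairs _∥_ P → AllPairs (Short 0) P → Star _⟶_ P [ u ] →
  size P ≤ length u
size-≤-output _ _ ε = ≤-reflexive (+-identityʳ _)
size-≤-output ps qs (m@(merge {x = x} {y} {z} {R} p _ record { left = refl ; right = refl } _) ◅ run)
  with (s-t ∷ _) ∷ _ ← AllPairs-↭ Short-sym p qs = ≤-trans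
    (≤-reflexive (trans (size-↭ p) (trans (size-merge x y z R)
      (cong (_+ size ((x ++ y ++ z) ∷ R)) (n≤0⇒n≡0 (forward s-t x y z refl refl))))))
    (size-≤-output (step-∥ m ps) (step-short m ps qs) run)

-- The encoding

zeros : ℕ → String
zeros n = replicate n 0

zeros-+ : ∀ m n → zeros (m + n) ≡ zeros m ++ zeros n
zeros-+ zero    n = refl
zeros-+ (suc m) n = cong (0 ∷_) (zeros-+ m n)

EndsWithZeros : ℕ → String → Set
EndsWithZeros w s = ∃ λ x → s ≡ x ++ zeros w

zeros-end : ∀ {w n} → w ≤ n → EndsWithZeros w (zeros n)
zeros-end {w} {n} w≤n = zeros (n ∸ w) ,
  trans (cong zeros (sym (m∸n+n≡m w≤n))) (zeros-+ (n ∸ w) w)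

zeros-start : ∀ {w n} → w ≤ n → ∃ λ x → zeros n ≡ zeros w ++ x
zeros-start {w} {n} w≤n = zeros (n ∸ w) ,
  trans (cong zeros (sym (m+[n∸m]≡n w≤n))) (zeros-+ w (n ∸ w))

end-++ : ∀ a {w s} → EndsWithZeros w s → EndsWithZeros w (a ++ s)
end-++ a (x , refl) = a ++ x , sym (++-assoc a x _)

-- Letters are encoded shifted by `suc`, which frees 0 for padding. Decoding is a homomorphism, so
-- it carries substrings and overlaps of encodings back to the original strings.
decode : String → String
decode []          = []
decode (zero  ∷ s) = decode s
decode (suc c ∷ s) = c ∷ decode s

decode-++ : ∀ s t → decode (s ++ t) ≡ decode s ++ decode t
decode-++ []          t = refl
decode-++ (zero  ∷ s) t = decode-++ s t
decode-++ (suc c ∷ s) t = cong (c ∷_) (decode-++ s t)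

decode-zeros : ∀ n → decode (zeros n) ≡ []
decode-zeros zero    = refl
decode-zeros (suc n) = decode-zeros n

decode-⊑ : ∀ {s t} → s ⊑ t → decode s ⊑ decode t
decode-⊑ {s} s⊑t with a , b , refl ← ⊑-elim s⊑t =
  subst (decode s ⊑_)
    (sym (trans (decode-++ a (s ++ b)) (cong (decode a ++_) (decode-++ s b))))
    (⊑-intro (decode a) (decode s) (decode b))

-- `pre` and `post` are the tie-breaking weights. They are kept apart from `m`, so that one
-- labelling serves every scale.
record Label : Set where
  constructor ⟨_,_,_⟩
  field
    pre  : ℕ
    str  : String
    post : ℕ

open Label public

module Encoding (m N : ℕ) where

  -- Wide enough to end with the leading zeros, or to start with the trailing zeros, of any encoding
  -- with weights at most `N`.
  gap : ℕ
  gap = m + N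

  m+post≤gap : ∀ {e} → e ≤ N → m + e ≤ gap
  m+post≤gap = +-monoʳ-≤ m

  -- A homomorphism, unlike `body`, whose last gap is special; inner factors of encodings are
  -- expressed by it.
  spread : String → String
  spread = concatMap (λ c → suc c ∷ zeros gap)

  body : ℕ → String → String
  body f []          = []
  body f (c ∷ [])    = suc c ∷ zeros f
  body f (c ∷ d ∷ s) = suc c ∷ zeros gap ++ body f (d ∷ s)

  enc : Label → String
  enc ⟨ w , s , e ⟩ = zeros w ++ body (m + e) s

  spread-++ : ∀ s t → spread (s ++ t) ≡ spread s ++ spread t
  spread-++ = concatMap-++ _

  body-++ : ∀ f s d t → body f (s ++ d ∷ t) ≡ spread s ++ body f (d ∷ t)
  body-++ f []          d t = refl
  body-++ f (c ∷ [])    d t = cong (λ u → suc c ∷ u ++ body f (d ∷ t)) (sym (++-identityʳ (zeros gap)))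
  body-++ f (c ∷ e ∷ s) d t = cong (suc c ∷_)
    (trans (cong (zeros gap ++_) (body-++ f (e ∷ s) d t)) (sym (++-assoc (zeros gap) _ _)))

  length-spread : ∀ s → length (spread s) ≡ length s * suc gap
  length-spread []      = refl
  length-spread (c ∷ s) = cong suc (trans (length-++ (zeros gap))
    (cong₂ _+_ (length-replicate gap) (length-spread s)))

  length-body-∷ʳ : ∀ f i c → length (body f (i ∷ʳ c)) ≡ length i * suc gap + suc f
  length-body-∷ʳ f i c = trans (cong length (body-++ f i c []))
    (trans (length-++ (spread i)) (cong₂ _+_ (length-spread i) (cong suc (length-replicate f))))

  decode-spread : ∀ s → decode (spread s) ≡ s
  decode-spread []      = refl
  decode-spread (c ∷ s) = cong (c ∷_) (trans (decode-++ (zeros gap) (spread s))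
    (cong₂ _++_ (decode-zeros gap) (decode-spread s)))

  decode-body : ∀ f s → decode (body f s) ≡ s
  decode-body f []          = refl
  decode-body f (c ∷ [])    = cong (c ∷_) (decode-zeros f)
  decode-body f (c ∷ d ∷ s) = cong (c ∷_) (trans (decode-++ (zeros gap) _)
    (cong₂ _++_ (decode-zeros gap) (decode-body f (d ∷ s))))

  decode-enc : ∀ l → decode (enc l) ≡ str l
  decode-enc ⟨ w , s , e ⟩ = trans (decode-++ (zeros w) _)
    (cong₂ _++_ (decode-zeros w) (decode-body (m + e) s))

  enc-∥ : ∀ {l l′} → str l ∥ str l′ → enc l ∥ enc l′
  enc-∥ {l} {l′} (p , q) =
    (λ r → p (subst₂ _⊑_ (decode-enc l) (decode-enc l′) (decode-⊑ r))) ,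
    (λ r → q (subst₂ _⊑_ (decode-enc l′) (decode-enc l) (decode-⊑ r)))

  -- The final zeros come from the last gap, or from the front if `s` is empty. The count `n` is
  -- general because the induction replaces it by `gap`.
  spread-end : ∀ s {w n} → w ≤ n → w ≤ gap → EndsWithZeros w (zeros n ++ spread s)
  spread-end []      {w} {n} w≤n _     =
    subst (EndsWithZeros w) (sym (++-identityʳ (zeros n))) (zeros-end w≤n)
  spread-end (c ∷ s) {w} {n} _   w≤gap =
    end-++ (zeros n) (end-++ [ suc c ] (spread-end s w≤gap w≤gap))

  -- At most `j` zeros precede the first letter and at most `gap` follow each letter. The count `j`
  -- is general so that the induction can walk through the zeros of a gap.
  prefix-length : ∀ {f} → f ≤ gap → ∀ j s y {z} → zeros j ++ body f s ≡ y ++ z →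
    length y ≤ j + length (decode y) * suc gap
  prefix-length f≤ j       s           []       _  = z≤n
  prefix-length f≤ (suc j) s           (_ ∷ y)  eq
    with refl ← ∷-injectiveˡ eq = s≤s (prefix-length f≤ j s y (∷-injectiveʳ eq))
  prefix-length {f} f≤ zero (c ∷ [])    (_ ∷ y) eq
    with refl ← ∷-injectiveˡ eq = s≤s (≤-trans
      (prefix-length f≤ f [] y (trans (++-identityʳ (zeros f)) (∷-injectiveʳ eq)))
      (+-monoˡ-≤ _ f≤))
  prefix-length f≤ zero    (c ∷ d ∷ s) (_ ∷ y) eq
    with refl ← ∷-injectiveˡ eq = s≤s (prefix-length f≤ gap (d ∷ s) y (∷-injectiveʳ eq))

  -- A suffix that contains some letter contains the last one and all `f` zeros behind it; a suffix
  -- starting later decodes to the empty string.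
  suffix-end : ∀ w f s x y → zeros w ++ body f s ≡ x ++ y → decode y ≢ [] →
    ∃₂ λ y′ c → y ≡ y′ ++ suc c ∷ zeros f
  suffix-end w f s x y eq y≢[] with initLast s
  ... | [] = contradiction
        (++-conicalʳ (decode x) (decode y) (trans (sym (decode-++ x y))
          (trans (cong decode (sym eq)) (trans (decode-++ (zeros w) [])
            (trans (++-identityʳ _) (decode-zeros w)))))) y≢[]
  ... | i ∷ʳ′ c with ++-split (zeros w ++ spread i) x (trans (++-assoc (zeros w) (spread i) _)
          (trans (cong (zeros w ++_) (sym (body-++ f i c []))) eq))
  ...   | inj₁ (y′ , _ , p) = y′ , c , p
  ...   | inj₂ (_ , k , _ , p) = contradiction
          (++-conicalʳ (decode k) (decode y) (trans (sym (decode-++ k y))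
            (trans (cong decode (sym (∷-injectiveʳ p))) (decode-zeros f)))) y≢[]

  -- The last letter of the overlap is followed by exactly m + e zeros instead of a full gap of m +
  -- N, and `prefix-length` bounds the rest. Adding `N` on the left avoids subtraction.
  overlap-length : ∀ {w e w′ e′ s t} → e ≤ N → e′ ≤ N → ∀ x y {z} →
    enc ⟨ w , s , e ⟩ ≡ x ++ y → enc ⟨ w′ , t , e′ ⟩ ≡ y ++ z → decode y ≢ [] →
    length y + N ≤ (w′ + e) + length (decode y) * suc gap
  overlap-length {w} {e} {w′} {e′} {s} {t} e≤ e′≤ x y {z} p q y≢[]
    with y′ , c , refl ← suffix-end w (m + e) s x y p y≢[] = begin
      length (y′ ++ suc c ∷ zeros (m + e)) + N
        ≡⟨ cong (_+ N) (length-++ y′) ⟩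
      length y′ + suc (length (zeros (m + e))) + N
        ≡⟨ cong (λ n → length y′ + suc n + N) (length-replicate (m + e)) ⟩
      length y′ + suc (m + e) + N
        ≤⟨ +-monoˡ-≤ N (+-monoˡ-≤ (suc (m + e)) (prefix-length (m+post≤gap e′≤) w′ t y′
             (trans q (++-assoc y′ _ z)))) ⟩
      w′ + length (decode y′) * suc gap + suc (m + e) + N
        ≡⟨ lemma w′ (length (decode y′)) m e N ⟩
      w′ + e + suc (length (decode y′)) * suc gap
        ≡⟨ cong (λ n → w′ + e + n * suc gap) (sym (trans (cong length dec)
             (trans (length-++ (decode y′)) (+-comm _ 1)))) ⟩
      w′ + e + length (decode (y′ ++ suc c ∷ zeros (m + e))) * suc gap ∎
    where
    open ≤-Reasoning
    dec : decode (y′ ++ suc c ∷ zeros (m + e)) ≡ decode y′ ++ [ c ]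
    dec = trans (decode-++ y′ _) (cong (λ u → decode y′ ++ c ∷ u) (decode-zeros (m + e)))
    open +-*-Solver
    lemma : ∀ w k m e n → w + k * suc (m + n) + suc (m + e) + n ≡ w + e + suc k * suc (m + n)
    lemma = solve 5 (λ w k m e n → w :+ k :* (con 1 :+ (m :+ n)) :+ (con 1 :+ (m :+ e)) :+ n
      := w :+ e :+ (con 1 :+ k) :* (con 1 :+ (m :+ n))) refl

  -- The common factor attains the bound of `overlap-length`, and the merge is again an encoding,
  -- which keeps the outer weights.
  record Split (w e w′ e′ : ℕ) (x y z : String) : Set where
    field
      left right common : String
      enc-left   : enc ⟨ w , x ++ y , e ⟩ ≡ left ++ common
      enc-right  : enc ⟨ w′ , y ++ z , e′ ⟩ ≡ common ++ right
      enc-merge  : enc ⟨ w , x ++ y ++ z , e′ ⟩ ≡ left ++ common ++ right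
      common-length : length common + N ≡ (w′ + e) + length y * suc gap

  -- Since the left remainder is nonempty, a gap precedes the shared letters and ends with the `w′`
  -- leading zeros of the right encoding. Since the right remainder is nonempty, a gap follows them
  -- and starts with the m + e trailing zeros of the left one.
  split : ∀ {w e w′ e′} → w′ ≤ N → e ≤ N → ∀ a x i c d z →
    Split w e w′ e′ (a ∷ x) (i ∷ʳ c) (d ∷ z)
  split {w} {e} {w′} {e′} w′≤ e≤ a x i c d z
    with X , p ← end-++ (zeros w ++ [ suc a ])
                       (spread-end x (≤-trans w′≤ (m≤n+m N m)) (≤-trans w′≤ (m≤n+m N m)))
       | Z , q ← zeros-start (m+post≤gap e≤)
    = record
    { left = X
    ; right = Z ++ body f′ (d ∷ z)
    ; common = zeros w′ ++ spread i ++ suc c ∷ zeros f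
    ; enc-left = begin
        zeros w ++ body f (a ∷ x ++ i ++ [ c ])
          ≡⟨ cong (λ u → zeros w ++ body f (a ∷ u)) (sym (++-assoc x i [ c ])) ⟩
        zeros w ++ body f ((a ∷ x ++ i) ++ [ c ])
          ≡⟨ cong (zeros w ++_) (body-++ f (a ∷ x ++ i) c []) ⟩
        zeros w ++ spread (a ∷ x ++ i) ++ suc c ∷ zeros f
          ≡⟨ front i (suc c ∷ zeros f) ⟩
        X ++ zeros w′ ++ spread i ++ suc c ∷ zeros f ∎
    ; enc-right = begin
        zeros w′ ++ body f′ ((i ++ [ c ]) ++ d ∷ z)
          ≡⟨ cong (zeros w′ ++_) (back i) ⟩
        zeros w′ ++ spread i ++ suc c ∷ zeros f ++ Z ++ body f′ (d ∷ z)
          ≡⟨ cong (zeros w′ ++_) (sym (++-assoc (spread i) (suc c ∷ zeros f) _)) ⟩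
        zeros w′ ++ (spread i ++ suc c ∷ zeros f) ++ Z ++ body f′ (d ∷ z)
          ≡⟨ sym (++-assoc (zeros w′) _ _) ⟩
        (zeros w′ ++ spread i ++ suc c ∷ zeros f) ++ Z ++ body f′ (d ∷ z) ∎
    ; enc-merge = begin
        zeros w ++ body f′ (a ∷ x ++ (i ++ [ c ]) ++ d ∷ z)
          ≡⟨ cong (λ u → zeros w ++ body f′ (a ∷ u)) (sym (trans
               (cong (_++ d ∷ z) (++-assoc x i [ c ])) (++-assoc x (i ++ [ c ]) (d ∷ z)))) ⟩
        zeros w ++ body f′ (((a ∷ x ++ i) ++ [ c ]) ++ d ∷ z)
          ≡⟨ cong (zeros w ++_) (back (a ∷ x ++ i)) ⟩
        zeros w ++ spread (a ∷ x ++ i) ++ suc c ∷ zeros f ++ Z ++ body f′ (d ∷ z)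
          ≡⟨ front i _ ⟩
        X ++ zeros w′ ++ spread i ++ suc c ∷ zeros f ++ Z ++ body f′ (d ∷ z)
          ≡⟨ cong (λ u → X ++ zeros w′ ++ u) (sym (++-assoc (spread i) (suc c ∷ zeros f) _)) ⟩
        X ++ zeros w′ ++ (spread i ++ suc c ∷ zeros f) ++ Z ++ body f′ (d ∷ z)
          ≡⟨ cong (X ++_) (sym (++-assoc (zeros w′) _ _)) ⟩
        X ++ (zeros w′ ++ spread i ++ suc c ∷ zeros f) ++ Z ++ body f′ (d ∷ z) ∎
    ; common-length = begin
        length (zeros w′ ++ spread i ++ suc c ∷ zeros f) + N
          ≡⟨ cong (_+ N) (trans (length-++ (zeros w′)) (cong₂ _+_ (length-replicate w′)
              (trans (length-++ (spread i)) (cong₂ _+_ (length-spread i) (cong suc (length-replicate f)))))) ⟩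
        w′ + (length i * suc gap + suc f) + N
          ≡⟨ lemma w′ (length i) m e N ⟩
        w′ + e + suc (length i) * suc gap
          ≡⟨ cong (λ n → w′ + e + n * suc gap) (sym (trans (length-++ i) (+-comm _ 1))) ⟩
        w′ + e + length (i ++ [ c ]) * suc gap ∎
    }
    where
    open ≡-Reasoning
    f  = m + e
    f′ = m + e′

    front : ∀ i u → zeros w ++ spread (a ∷ x ++ i) ++ u ≡ X ++ zeros w′ ++ spread i ++ u
    front i u = begin
      zeros w ++ spread (a ∷ x ++ i) ++ u
        ≡⟨ cong (λ v → zeros w ++ v ++ u) (spread-++ (a ∷ x) i) ⟩
      zeros w ++ (spread (a ∷ x) ++ spread i) ++ u
        ≡⟨ cong (zeros w ++_) (++-assoc (spread (a ∷ x)) (spread i) u) ⟩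
      zeros w ++ spread (a ∷ x) ++ spread i ++ u
        ≡⟨ sym (++-assoc (zeros w) (spread (a ∷ x)) _) ⟩
      (zeros w ++ spread (a ∷ x)) ++ spread i ++ u
        ≡⟨ cong (_++ spread i ++ u) (trans (sym (++-assoc (zeros w) [ suc a ] _)) p) ⟩
      (X ++ zeros w′) ++ spread i ++ u
        ≡⟨ ++-assoc X (zeros w′) _ ⟩
      X ++ zeros w′ ++ spread i ++ u ∎

    back : ∀ i → body f′ ((i ++ [ c ]) ++ d ∷ z) ≡ spread i ++ suc c ∷ zeros f ++ Z ++ body f′ (d ∷ z)
    back i = begin
      body f′ ((i ++ [ c ]) ++ d ∷ z)
        ≡⟨ cong (body f′) (++-assoc i [ c ] (d ∷ z)) ⟩
      body f′ (i ++ c ∷ d ∷ z)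
        ≡⟨ body-++ f′ i c (d ∷ z) ⟩
      spread i ++ suc c ∷ zeros gap ++ body f′ (d ∷ z)
        ≡⟨ cong (λ u → spread i ++ suc c ∷ u)
             (trans (cong (_++ body f′ (d ∷ z)) q) (++-assoc (zeros f) Z _)) ⟩
      spread i ++ suc c ∷ zeros f ++ Z ++ body f′ (d ∷ z) ∎

    lemma : ∀ w k m e n → w + (k * suc (m + n) + suc (m + e)) + n ≡ w + e + suc k * suc (m + n)
    lemma = solve 5 (λ w k m e n → w :+ (k :* (con 1 :+ (m :+ n)) :+ (con 1 :+ (m :+ e))) :+ n
      := w :+ e :+ (con 1 :+ k) :* (con 1 :+ (m :+ n))) refl
      where open +-*-Solver

  -- Only the last gap can fall short, and by at most `N`, since it keeps `m` zeros.
  length-enc : ∀ w s e → length s * suc gap ≤ length (enc ⟨ w , s , e ⟩) + N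
  length-enc w s e with initLast s
  ... | [] = z≤n
  ... | i ∷ʳ′ c = begin
    length (i ++ [ c ]) * suc gap
      ≡⟨ cong (_* suc gap) (trans (length-++ i) (+-comm _ 1)) ⟩
    suc gap + length i * suc gap
      ≤⟨ m≤n+m _ (w + e) ⟩
    (w + e) + (suc gap + length i * suc gap)
      ≡⟨ lemma w e m N (length i * suc gap) ⟩
    w + (length i * suc gap + suc (m + e)) + N
      ≡⟨ cong (_+ N) (sym (trans (length-++ (zeros w))
           (cong₂ _+_ (length-replicate w) (length-body-∷ʳ (m + e) i c)))) ⟩
    length (zeros w ++ body (m + e) (i ++ [ c ])) + N ∎
    where
    open ≤-Reasoning
    lemma : ∀ w e m n k → (w + e) + (suc (m + n) + k) ≡ w + (k + suc (m + e)) + n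
    lemma = solve 5 (λ w e m n k → (w :+ e) :+ ((con 1 :+ (m :+ n)) :+ k)
      := w :+ (k :+ (con 1 :+ (m :+ e))) :+ n) refl
      where open +-*-Solver

  body-start : ∀ {e} → e ≤ N → ∀ s → ∃ λ z → spread s ≡ body (m + e) s ++ z
  body-start e≤ []          = [] , refl
  body-start e≤ (c ∷ [])    with z , q ← zeros-start (m+post≤gap e≤) =
    z , cong (suc c ∷_) (trans (++-identityʳ (zeros gap)) q)
  body-start e≤ (c ∷ d ∷ s) with z , q ← body-start e≤ (d ∷ s) =
    z , cong (suc c ∷_) (trans (cong (zeros gap ++_) q) (sym (++-assoc (zeros gap) _ z)))

  -- The `N` zeros in front make room for the leading zeros of a string occurring at the very start
  -- of `o`; elsewhere the preceding gap does.
  enc-superstring : ∀ {w s e o} → w ≤ N → e ≤ N → s ⊑ o →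
    enc ⟨ w , s , e ⟩ ⊑ (zeros N ++ spread o)
  enc-superstring {w} {s} {e} w≤ e≤ s⊑o with a , b , refl ← ⊑-elim s⊑o
    with X , p ← spread-end a w≤ (≤-trans w≤ (m≤n+m N m))
       | Z , q ← body-start e≤ s
    = subst (enc ⟨ w , s , e ⟩ ⊑_) (sym (begin
        zeros N ++ spread (a ++ s ++ b)
          ≡⟨ cong (zeros N ++_) (spread-++ a (s ++ b)) ⟩
        zeros N ++ spread a ++ spread (s ++ b)
          ≡⟨ sym (++-assoc (zeros N) (spread a) _) ⟩
        (zeros N ++ spread a) ++ spread (s ++ b)
          ≡⟨ cong₂ _++_ p (trans (spread-++ s b) (cong (_++ spread b) q)) ⟩
        (X ++ zeros w) ++ (body (m + e) s ++ Z) ++ spread b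
          ≡⟨ ++-assoc X (zeros w) _ ⟩
        X ++ zeros w ++ (body (m + e) s ++ Z) ++ spread b
          ≡⟨ cong (λ u → X ++ zeros w ++ u) (++-assoc (body (m + e) s) Z _) ⟩
        X ++ zeros w ++ body (m + e) s ++ Z ++ spread b
          ≡⟨ cong (X ++_) (sym (++-assoc (zeros w) _ _)) ⟩
        X ++ enc ⟨ w , s , e ⟩ ++ Z ++ spread b ∎))
      (⊑-intro X _ (Z ++ spread b))
    where
    open ≡-Reasoning

-- Forcing greedy runs

first-pair : ∀ {A : Set} {R : A → A → Set} {x y xs} → AllPairs R (x ∷ y ∷ xs) → R x y
first-pair ((p ∷ _) ∷ _) = p

Bounded : ℕ → Label → Set
Bounded n l = pre l ≤ n × post l ≤ n

-- Quantifying over all greedy runs on the encodings makes this independent of tie-breaking. The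
-- error allows `N` for each of at most `N` strings.
Forces : ℕ → List Label → String → Set
Forces N L u = ∀ m {P v} → P ↭ map (Encoding.enc m N) L → Star _⟶_ P [ v ] →
  length u * suc (m + N) ≤ length v + N * N

plain : String → Label
plain s = ⟨ 0 , s , 0 ⟩

module _ (m N : ℕ) where
  open Encoding m N

  -- The overlap decodes to the empty string, hence lies within the leading zeros, and a plain label
  -- has none.
  plain-bound : ∀ {s t} → OverlapBound 0 s t → OverlapBound 0 (enc (plain s)) (enc (plain t))
  plain-bound {s} {t} short x y z p q = subst (λ k → length y ≤ k * suc gap)
    (n≤0⇒n≡0 (short (decode x) (decode y) (decode z)
      (trans (sym (decode-enc (plain s))) (trans (cong decode p) (decode-++ x y)))
      (trans (sym (decode-enc (plain t))) (trans (cong decode q) (decode-++ y z)))))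
    (prefix-length (m+post≤gap z≤n) 0 t y q)

  size-plain : ∀ P → size P * suc gap ≤ size (map enc (map plain P)) + length P * N
  size-plain []      = z≤n
  size-plain (s ∷ P) = begin
    (length s + size P) * suc gap                ≡⟨ *-distribʳ-+ (suc gap) (length s) (size P) ⟩
    length s * suc gap + size P * suc gap        ≤⟨ +-mono-≤ (length-enc 0 s 0) (size-plain P) ⟩
    (length s′ + N) + (size P′ + length P * N)   ≡⟨ lemma (length s′) N (size P′) (length P * N) ⟩
    (length s′ + size P′) + (N + length P * N)   ∎
    where
    open ≤-Reasoning
    s′ = enc (plain s)
    P′ = map enc (map plain P)
    lemma : ∀ a b c d → (a + b) + (c + d) ≡ (a + c) + (b + d)
    lemma = solve 4 (λ a b c d → (a :+ b) :+ (c :+ d) := (a :+ c) :+ (b :+ d)) refl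
      where open +-*-Solver

-- Without overlaps the encoded run only concatenates, so its length is the total length of the
-- encodings, whatever pairs it picks.
plain-forces : ∀ {P u N} → AllPairs _∥_ P → AllPairs (Short 0) P → Star _⟶_ P [ u ] →
  length P ≤ N → Forces N (map plain P) u
plain-forces {P} {u} {N} ps qs run P≤N m {P′} {v} p run′ = begin
  length u * suc gap                             ≤⟨ *-monoˡ-≤ (suc gap) (output-≤-size run) ⟩
  size P * suc gap                               ≤⟨ size-plain m N P ⟩
  size (map enc (map plain P)) + length P * N    ≡⟨ cong (_+ length P * N) (size-↭ (↭-sym p)) ⟩
  size P′ + length P * N                         ≤⟨ +-mono-≤ (size-≤-output ps′ qs′ run′) (*-monoˡ-≤ N P≤N) ⟩
  length v + N * N                               ∎
  where
  open Encoding m N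
  open ≤-Reasoning
  ps′ : AllPairs _∥_ P′
  ps′ = AllPairs-↭ ∥-sym (↭-sym p) (AllPairs.map⁺ (AllPairs.map⁺
    (AllPairs.map (λ {s} {t} → enc-∥ {plain s} {plain t}) ps)))
  qs′ : AllPairs (Short 0) P′
  qs′ = AllPairs-↭ Short-sym (↭-sym p) (AllPairs.map⁺ (AllPairs.map⁺
    (AllPairs.map (λ (f , b) → plain-bound m N f , plain-bound m N b) qs)))

module _ {n N a c d : ℕ} {x i z : String} {w e : ℕ} {L : List Label} {u : String} where

  private
    X = a ∷ x
    Y = i ∷ʳ c
    Z = d ∷ z
    l  = ⟨ w , X ++ Y , n ⟩
    r  = ⟨ n , Y ++ Z , e ⟩
    lr = ⟨ w , X ++ Y ++ Z , e ⟩

  -- Only l and r carry the maximal weight n on their facing ends, so they are the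
  -- unique pair of maximal overlap, and their merge is again an encoding.
  merge-forces : n ≤ N → w < n → e < n → All (λ l → pre l < n × post l < n) L →
    AllPairs _∥_ (map str (l ∷ r ∷ L)) → AllPairs (Short (length Y)) (map str (l ∷ r ∷ L)) →
    Forces N (lr ∷ L) u → Forces N (l ∷ r ∷ L) u
  merge-forces n≤N w<n e<n L<n ps qs forces m p ε with () ← ↭-length p
  merge-forces n≤N w<n e<n L<n ps qs forces m {P} p (merge {x = x′} {y′} {z′} p′ s≢t o g ◅ run)
    with l₁ ∷ l₂ ∷ L′ , refl , ρ ← ↭-map-inv (Encoding.enc m N) (↭-trans (↭-sym p) p′)
    = forces m (↭-trans (↭-reflexive (cong (_∷ map enc L′) merged)) (prep _ (map⁺ enc (↭-sym L↭L′)))) run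
    where
    open Encoding m N
    module S = Split (split {w} {n} {n} {e} n≤N n≤N a x i c d z)
    open ≤-Reasoning

    l∥r : enc l ∥ enc r
    l∥r = enc-∥ {l} {r} (first-pair ps)

    -- The pair `l`, `r` is available, so the greedy choice is at least as long as their common
    -- factor.
    common≤ : length S.common ≤ length y′
    common≤ = greedy-bound g
      (∈-resp-↭ (↭-sym p) (here refl)) (∈-resp-↭ (↭-sym p) (there (here refl))) (∥⇒≢ l∥r)
      S.left S.common S.right S.enc-left S.enc-right

    k = length (decode y′)

    k≤ : k ≤ length Y
    k≤ = Short.forward (first-pair (AllPairs-↭ Short-sym ρ (AllPairs.map⁻ qs)))
      (decode x′) (decode y′) (decode z′)
      (trans (sym (decode-enc l₁)) (trans (cong decode (Overlap.left o)) (decode-++ x′ y′)))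
      (trans (sym (decode-enc l₂)) (trans (cong decode (Overlap.right o)) (decode-++ y′ z′)))

    ≤n : All (Bounded n) (l ∷ r ∷ L)
    ≤n = (<⇒≤ w<n , ≤-refl) ∷ (≤-refl , <⇒≤ e<n) ∷ All.map (λ (p , q) → <⇒≤ p , <⇒≤ q) L<n

    l₁∈ : l₁ ∈ l ∷ r ∷ L
    l₁∈ = ∈-resp-↭ (↭-sym ρ) (here refl)

    l₂∈ : l₂ ∈ l ∷ r ∷ L
    l₂∈ = ∈-resp-↭ (↭-sym ρ) (there (here refl))

    post₁≤ : post l₁ ≤ n
    post₁≤ = proj₂ (All.lookup ≤n l₁∈)

    pre₂≤ : pre l₂ ≤ n
    pre₂≤ = proj₁ (All.lookup ≤n l₂∈)

    post₂≤N : post l₂ ≤ N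
    post₂≤N = ≤-trans (proj₂ (All.lookup ≤n l₂∈)) n≤N

    -- A missing letter costs gap + 1, more than `N`. Only `prefix-length` applies here, as the
    -- overlap might still have no letter at all.
    k≮ : ¬ k < length Y
    k≮ k< = <-irrefl refl (begin-strict
      (n + n) + length Y * suc gap      ≡⟨ S.common-length ⟨
      length S.common + N               ≤⟨ +-monoˡ-≤ N common≤ ⟩
      length y′ + N                     ≤⟨ +-monoˡ-≤ N (prefix-length (m+post≤gap post₂≤N)
                                             (pre l₂) (str l₂) y′ (Overlap.right o)) ⟩
      pre l₂ + k * suc gap + N          ≤⟨ +-monoˡ-≤ N (+-monoˡ-≤ (k * suc gap) pre₂≤) ⟩
      n + k * suc gap + N               ≡⟨ +-assoc n (k * suc gap) N ⟩
      n + (k * suc gap + N)             <⟨ +-monoʳ-< n (+-monoʳ-< (k * suc gap) (s≤s (m≤n+m N m))) ⟩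
      n + (k * suc gap + suc gap)       ≡⟨ cong (n +_) (+-comm (k * suc gap) (suc gap)) ⟩
      n + suc k * suc gap               ≤⟨ +-mono-≤ (m≤m+n n n) (*-monoˡ-≤ (suc gap) k<) ⟩
      (n + n) + length Y * suc gap      ∎)

    k≡ : k ≡ length Y
    k≡ = ≤-antisym k≤ (≮⇒≥ k≮)

    decode≢[] : decode y′ ≢ []
    decode≢[] q with () ← trans (sym (trans (length-++ i) (+-comm _ 1))) (trans (sym k≡) (cong length q))

    y′≤ : length y′ + N ≤ (pre l₂ + post l₁) + length Y * suc gap
    y′≤ = subst (λ j → length y′ + N ≤ (pre l₂ + post l₁) + j * suc gap) k≡
      (overlap-length {pre l₁} (≤-trans post₁≤ n≤N) post₂≤N x′ y′
        (Overlap.left o) (Overlap.right o) decode≢[])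

    -- The letter counts being equal, the comparison of lengths reduces to the facing weights; each
    -- is at most `n`, so both equal `n`.
    n+n≤ : n + n ≤ pre l₂ + post l₁
    n+n≤ = +-cancelʳ-≤ (length Y * suc gap) _ _ (begin
      (n + n) + length Y * suc gap               ≡⟨ S.common-length ⟨
      length S.common + N                        ≤⟨ +-monoˡ-≤ N common≤ ⟩
      length y′ + N                              ≤⟨ y′≤ ⟩
      (pre l₂ + post l₁) + length Y * suc gap    ∎)

    post₁≡ : post l₁ ≡ n
    post₁≡ = ≤-antisym post₁≤ (+-cancelˡ-≤ n _ _ (≤-trans n+n≤ (+-monoˡ-≤ _ pre₂≤)))

    pre₂≡ : pre l₂ ≡ n
    pre₂≡ = ≤-antisym pre₂≤ (+-cancelʳ-≤ n _ _ (≤-trans n+n≤ (+-monoʳ-≤ _ post₁≤)))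

    l₁≡ : l₁ ≡ l
    l₁≡ with l₁∈
    ... | here q           = q
    ... | there (here q)   = contradiction (trans (cong post (sym q)) post₁≡) (<⇒≢ e<n)
    ... | there (there l∈) = contradiction post₁≡ (<⇒≢ (proj₂ (All.lookup L<n l∈)))

    l₂≡ : l₂ ≡ r
    l₂≡ with l₂∈
    ... | here q           = contradiction (trans (cong pre (sym q)) pre₂≡) (<⇒≢ w<n)
    ... | there (here q)   = q
    ... | there (there l∈) = contradiction pre₂≡ (<⇒≢ (proj₁ (All.lookup L<n l∈)))

    L↭L′ : L ↭ L′
    L↭L′ = drop-∷ (drop-∷ (subst₂ (λ a b → l ∷ r ∷ L ↭ a ∷ b ∷ L′) l₁≡ l₂≡ ρ))

    y′≡ : length y′ ≡ length S.common
    y′≡ = ≤-antisym (+-cancelʳ-≤ N _ _ (≤-trans y′≤ (≤-reflexive (trans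
      (cong₂ (λ a b → a + b + length Y * suc gap) pre₂≡ post₁≡) (sym S.common-length))))) common≤

    -- Two factorisations of `enc r` with first factors of equal length have the same remainder.
    z′≡ : z′ ≡ S.right
    z′≡ = ++-cancel-length y′ S.common y′≡
      (trans (sym (Overlap.right o)) (trans (cong enc l₂≡) S.enc-right))

    merged : x′ ++ y′ ++ z′ ≡ enc lr
    merged = trans (sym (++-assoc x′ y′ z′)) (trans
      (cong₂ _++_ (trans (sym (Overlap.left o)) (trans (cong enc l₁≡) S.enc-left)) z′≡)
      (trans (++-assoc S.left S.common S.right) (sym S.enc-merge)))

-- `N` is any number from `length P` on, because the labelling of a later, shorter list is reused
-- with the `N` of the initial one.
record Labelling (P : List String) (u : String) : Set where
  field
    labels  : List Label
    strs    : map str labels ↭ P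
    bounded : All (Bounded (length P)) labels
    forces  : ∀ {N} → length P ≤ N → Forces N labels u

plain-labelling : ∀ {P u} → AllPairs _∥_ P → AllPairs (Short 0) P → Star _⟶_ P [ u ] → Labelling P u
plain-labelling {P} ps qs run = record
  { labels  = map plain P
  ; strs    = ↭-reflexive (trans (sym (map-∘ P)) (map-id P))
  ; bounded = All.map⁺ (All.universal (λ _ → z≤n , z≤n) P)
  ; forces  = plain-forces ps qs run
  }

-- The label of the merged string is divided: its weights stay on the outer ends, and the facing
-- ends receive `length P`, which exceeds every weight used for the shorter list.
merge-labelling : ∀ {P R u} x y z → y ≢ [] → P ↭ (x ++ y) ∷ (y ++ z) ∷ R →
  AllPairs _∥_ ((x ++ y) ∷ (y ++ z) ∷ R) → AllPairs (Short (length y)) ((x ++ y) ∷ (y ++ z) ∷ R) →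
  Labelling ((x ++ y ++ z) ∷ R) u → Labelling P u
merge-labelling x y z y≢[] p ps qs rec with initLast y
merge-labelling x       .[]        z       y≢[] p ps qs rec | []       = contradiction refl y≢[]
-- An empty `x` or `z` would make one of the two strings a substring of the other, so both
-- remainders required by `split` are nonempty.
merge-labelling []      .(i ∷ʳ c)  z       _    p ps qs rec | i ∷ʳ′ c =
  contradiction (++-⊑ˡ (i ∷ʳ c) z) (_∥_.⋢ (first-pair ps))
merge-labelling (a ∷ x) .(i ∷ʳ c)  []      _    p ps qs rec | i ∷ʳ′ c = contradiction
  (subst (_⊑ (a ∷ x ++ i ∷ʳ c)) (sym (++-identityʳ (i ∷ʳ c))) (++-⊑ʳ (a ∷ x) (i ∷ʳ c)))
  (_∥_.⋣ (first-pair ps))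
merge-labelling {u = u} (a ∷ x) .(i ∷ʳ c) (d ∷ z) _    p ps qs rec | i ∷ʳ′ c
  with ⟨ w , _ , e ⟩ ∷ L , refl , ρ ← ↭-map-inv str (Labelling.strs rec)
  with (w≤ , e≤) ∷ L≤ ← All-resp-↭ ρ (Labelling.bounded rec) = record
  { labels  = L⁺
  ; strs    = ↭-sym p
  ; bounded = subst (λ k → All (Bounded k) L⁺) (sym (↭-length p))
      ((m≤n⇒m≤1+n w≤ , ≤-refl) ∷ (≤-refl , m≤n⇒m≤1+n e≤)
        ∷ All.map (λ (p , q) → m≤n⇒m≤1+n p , m≤n⇒m≤1+n q) L≤)
  ; forces  = λ {N} P≤N → let n≤N = subst (_≤ N) (↭-length p) P≤N in
      merge-forces {a = a} {c} {d} {x} {i} {z} {u = u} n≤N (s≤s w≤) (s≤s e≤)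
        (All.map (λ (p , q) → s≤s p , s≤s q) L≤) ps qs
        λ m q → Labelling.forces rec (≤-trans (n≤1+n _) n≤N) m
          (↭-trans q (map⁺ (Encoding.enc m N) (↭-sym ρ)))
  }
  where
  n = suc (suc (length (map str L)))
  L⁺ = ⟨ w , (a ∷ x) ++ i ∷ʳ c , n ⟩ ∷ ⟨ n , i ∷ʳ c ++ d ∷ z , e ⟩ ∷ L

labelling : ∀ {P u} → AllPairs _∥_ P → Star _⟶_ P [ u ] → Labelling P u
labelling ps ε = plain-labelling ps ([] ∷ []) ε
labelling ps (step@(merge {x = x} {y} {z} p _ record { left = refl ; right = refl } g) ◅ run)
  with length y ≟ 0
-- If the longest overlap is empty, then all are, and the rest of the run needs no weights.
... | yes y≡0 = plain-labelling ps
        (subst (λ k → AllPairs (Short k) _) y≡0 (greedy-short g ps)) (step ◅ run)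
... | no  y≢0 = merge-labelling x y z (λ { refl → y≢0 refl }) p (AllPairs-↭ ∥-sym p ps)
        (AllPairs-↭ Short-sym p (greedy-short g ps)) (labelling (step-∥ step ps) run)

-- Datasets and approximation factors

dataset-∥ : ∀ S → AllPairs _∥_ (strings S)
dataset-∥ S = AllPairs-zip∈
  (λ s∈ t∈ s≢t → (antichain S s∈ t∈ s≢t , antichain S t∈ s∈ (≢-sym s≢t))) (unique S)

∥-antichain : ∀ {P s t} → AllPairs _∥_ P → s ∈ P → t ∈ P → s ≢ t → ¬ (s ⊑ t)
∥-antichain (_  ∷ _)  (here refl) (here refl) s≢t = contradiction refl s≢t
∥-antichain (p  ∷ _)  (here refl) (there t∈)  _   = _∥_.⋢ (All.lookup p t∈)
∥-antichain (p  ∷ _)  (there s∈)  (here refl) _   = _∥_.⋣ (All.lookup p s∈)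
∥-antichain (_  ∷ ps) (there s∈)  (there t∈)  s≢t = ∥-antichain ps s∈ t∈ s≢t

∥-dataset : ∀ P → P ≢ [] → AllPairs _∥_ P → Dataset
∥-dataset P P≢[] ps = record
  { strings = P ; nonEmpty = P≢[] ; unique = AllPairs.map ∥⇒≢ ps ; antichain = ∥-antichain ps }

-- If there were no optimum, every superstring would admit a shorter one; the descent is on a bound
-- `n` for the length.
¬¬-OPT : ∀ S {v} → IsSuperstring S v → ¬ ¬ (∃ λ u → IsOPT S u)
¬¬-OPT S {v} v⊒S none = no-superstring (suc (length v)) v⊒S ≤-refl
  where
  no-superstring : ∀ n {v} → IsSuperstring S v → length v < n → ⊥
  no-superstring (suc n) {v} v⊒S (s≤s v≤n) = none (v , v⊒S , λ w w⊒S →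
    ≮⇒≥ λ w<v → no-superstring n w⊒S (<-≤-trans w<v v≤n))

-- What the limit argument needs from the encoding: both lengths are scaled by m + N + 1, with
-- errors that do not depend on `m`.
record Scaled (S : Dataset) (b o : String) (m : ℕ) : Set where
  private
    N = length (strings S)
  field
    dataset       : Dataset
    greedy-long   : ∀ {v} → GreedyOutput dataset v → length b * suc (m + N) ≤ length v + N * N
    superstring   : String
    contains      : IsSuperstring dataset superstring
    optimum-short : length superstring ≤ N + length o * suc (m + N)

scale : ∀ S {b o} → GreedyOutput S b → IsSuperstring S o → ∀ m → Scaled S b o m
scale S {b} {o} run o⊒S m = record
  { dataset       = ∥-dataset (map enc L) (λ p → nonEmpty S (map-empty L p strs))
      (AllPairs.map⁺ (AllPairs.map (λ {l} {l′} → enc-∥ {l} {l′})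
        (AllPairs.map⁻ (AllPairs-↭ ∥-sym (↭-sym strs) (dataset-∥ S)))))
  ; greedy-long   = forces ≤-refl m ↭-refl
  ; superstring   = zeros N ++ spread o
  ; contains      = All.map⁺ (All.zipWith
      (λ ((p , q) , r) → enc-superstring p q r)
      (bounded , All.map⁻ (All-resp-↭ (↭-sym strs) o⊒S)))
  ; optimum-short = ≤-reflexive (trans (length-++ (zeros N))
      (cong₂ _+_ (length-replicate N) (length-spread o)))
  }
  where
  N = length (strings S)
  open Encoding m N
  open Labelling (labelling (dataset-∥ S) run) renaming (labels to L)
  map-empty : ∀ L → map enc L ≡ [] → map str L ↭ strings S → strings S ≡ []
  map-empty [] _ p with strings S | ↭-length p
  ... | [] | _ = refl

singleton-output : ∀ {s u} → Star _⟶_ [ s ] [ u ] → u ≡ s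
singleton-output ε = refl
singleton-output (merge p _ _ _ ◅ _) with () ← ↭-length p

unit : Dataset
unit = ∥-dataset [ [ 0 ] ] (λ ()) ([] ∷ [])

unit-opt : IsOPT unit [ 0 ]
unit-opt = (⊑-refl ∷ []) , λ { _ (p ∷ []) → nonEmpty⇒ p }
  where
  nonEmpty⇒ : ∀ {v} → [ 0 ] ⊑ v → 1 ≤ length v
  nonEmpty⇒ {[]}    p with [] , _ , () ← ⊑-elim p
  nonEmpty⇒ {_ ∷ _} _ = s≤s z≤n

-- For a single string of length 1 the approximation with tolerance 1 reads 1 ≤ q + 1. The sign is
-- needed in `descale`, where `q` multiplies an upper bound.
eventually-nonneg : ∀ r A → r -approximate A → ∃ λ N → ∀ n → N ≤ n → 0ℚ ℚ.≤ seq r n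
eventually-nonneg r A approx = let N , late = approx unit unit-opt 1ℚ (ℚ.positive⁻¹ 1ℚ) in
  N , λ n N≤n → cancel (seq r n) (subst
    (λ u → ι (length u) ℚ.≤ seq r n ℚ.* ι 1 ℚ.+ 1ℚ) (singleton-output (output-run A unit)) (late n N≤n))
  where
  open ℚ.≤-Reasoning
  open ℚ-Solver
  cancel : ∀ q → 1ℚ ℚ.≤ q ℚ.* 1ℚ ℚ.+ 1ℚ → 0ℚ ℚ.≤ q
  cancel q p = begin
    0ℚ                          ≤⟨ ℚ.+-monoˡ-≤ (ℚ.- 1ℚ) p ⟩
    q ℚ.* 1ℚ ℚ.+ 1ℚ ℚ.- 1ℚ      ≡⟨ solve 1 (λ q → q :* con 1ℚ :+ con 1ℚ :- con 1ℚ := q) refl q ⟩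
    q                           ∎

-- The scale `m` is chosen before the index of the sequence, so the error term needs a bound uniform
-- in that index.
eventually-bounded : ∀ r → ∃ λ K → ∃ λ N → ∀ n → N ≤ n → seq r n ℚ.≤ K
eventually-bounded r = let N , close = cauchy r 1ℚ (ℚ.positive⁻¹ 1ℚ) in
  seq r N ℚ.+ 1ℚ , N , λ n N≤n → ∣p-q∣≤⇒p≤q+ (close n N N≤n ≤-refl)

theorem4 : (r : ℝ) → (∃[ A ] r -approximate A) → (B : Instantiation) → r -approximate B
theorem4 r (A , approx) B S {u} (u⊒S , _) =
  ≤ʳ-stable {x = fromℕ (length (output B S))} {y = r *ʳ fromℕ (length u)} λ δ 0<δ →
    let N₁ , 0≤r     = eventually-nonneg r A approx
        K , N₂ , r≤K = eventually-bounded r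
        -- This `m` absorbs the optimum's error `N` multiplied by the ratio, the tolerance 1 and the
        -- greedy error `N * N`.
        m , big      = archimedean 0<δ (K ℚ.* ι N ℚ.+ 1ℚ ℚ.+ ι (N * N))
    in scaled-bound δ 0<δ N₁ 0≤r K N₂ r≤K m big
  where
  N = length (strings S)

  scaled-bound : ∀ δ → 0ℚ ℚ.< δ →
    ∀ N₁ → (∀ n → N₁ ≤ n → 0ℚ ℚ.≤ seq r n) → ∀ K N₂ → (∀ n → N₂ ≤ n → seq r n ℚ.≤ K) →
    ∀ m → K ℚ.* ι N ℚ.+ 1ℚ ℚ.+ ι (N * N) ℚ.≤ ι m ℚ.* δ →
    ¬ ¬ ∃ λ n₀ → ∀ n → n₀ ≤ n → ι (length (output B S)) ℚ.≤ seq r n ℚ.* ι (length u) ℚ.+ δ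
  -- The goal has become absurdity, so an optimum of the encoded dataset may be assumed.
  scaled-bound δ 0<δ N₁ 0≤r K N₂ r≤K m big none = ¬¬-OPT dataset contains λ (u′ , opt) →
    let N₃ , a≤ = approx dataset opt 1ℚ (ℚ.positive⁻¹ 1ℚ) in
    none ((N₁ ⊔ N₂) ⊔ N₃ , λ n n₀≤n →
      let N₁₂≤n = ≤-trans (m≤m⊔n (N₁ ⊔ N₂) N₃) n₀≤n in
      descale {a = length (output A dataset)} {length (output B S)} {length u} {length u′}
        {N} {N * N} {m + N} {K} {seq r n} {δ}
        (0≤r n (≤-trans (m≤m⊔n N₁ N₂) N₁₂≤n))
        (r≤K n (≤-trans (m≤n⊔m N₁ N₂) N₁₂≤n))
        (greedy-long (output-run A dataset))
        (≤-trans (proj₂ opt superstring contains) optimum-short)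
        (a≤ n (≤-trans (m≤n⊔m (N₁ ⊔ N₂) N₃) n₀≤n))
        (ℚ.≤-trans big (ℚ.*-monoʳ-≤-nonNeg δ {{ℚ.nonNegative (ℚ.<⇒≤ 0<δ)}}
          (ι-mono {m} {suc (m + N)} (≤-trans (m≤m+n m N) (n≤1+n (m + N)))))))
    where open Scaled (scale S (output-run B S) u⊒S m)
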